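{- For every integer $n\geq 1$, $op_{2,1}(n,1)=\overline{p}(n)/2$.
   Context: An overpartition of $n$ is a partition of $n$ (a finite non-increasing sequence of positive integers summing to $n$) in which the last occurrence of each part size may be overlined. $\overline{p}(n)$ denotes the number of overpartitions of $n$. For an overpartition $\pi$, $\overline{mex}_{2,1}(\pi)$ denotes the smallest positive odd integer that does not occur as a non-overlined part of $\pi$. For $n\geq 1$ and $k\geq 0$, $op_{2,1}(n,k)$ denotes the number of overpartitions $\pi$ of $n$ such that $\overline{mex}_{2,1}(\pi)\geq 2k+1$ and $\overline{mex}_{2,1}(\pi)\equiv 2k+1 \pmod 4$. -}

module Defs where

open import Data.Nat using (ℕ; zero; suc; _+_; _*_; _<ᵇ_; _≤ᵇ_; _≡ᵇ_; _%_)
open import Data.Bool using (Bool; true; false; T; _∧_; _∨_; not; if_then_else_)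
open import Data.List using (List; []; _∷_; length; map)
open import Data.Nat.ListAction using (sum)
open import Data.Product using (Σ; _×_; _,_; proj₁)
open import Data.Fin using (Fin)
open import Function.Bundles using (_↔_)

-- An overpartition is represented as a list of (part , overlined?) pairs,
-- listed in non-increasing order of parts.  Within a block of equal parts,
-- only the LAST occurrence may carry the overline flag `true`.  This
-- representation is canonical (one list per overpartition).

validOP : List (ℕ × Bool) → Bool
validOP [] = true
validOP ((a , o) ∷ []) = 1 ≤ᵇ a
validOP ((a , o) ∷ (b , o') ∷ rest) =
  (b ≤ᵇ a) ∧ ((not o) ∨ (b <ᵇ a)) ∧ validOP ((b , o') ∷ rest)

size : List (ℕ × Bool) → ℕ
size l = sum (map proj₁ l)

IsOverpartition : ℕ → List (ℕ × Bool) → Set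
IsOverpartition n l = T (validOP l ∧ (size l ≡ᵇ n))

-- the type of overpartitions of n (T _ is proof-irrelevant, so equality of
-- elements is equality of the underlying lists)
Overpartition : ℕ → Set
Overpartition n = Σ (List (ℕ × Bool)) (IsOverpartition n)

occursNonOver : ℕ → List (ℕ × Bool) → Bool
occursNonOver j [] = false
occursNonOver j ((a , o) ∷ rest) = ((not o) ∧ (a ≡ᵇ j)) ∨ occursNonOver j rest

-- smallest odd j ≥ start (start odd) not occurring as a non-overlined part,
-- searched with `fuel` steps; fuel = length l suffices since at most
-- length l distinct values occur.
mexSearch : ℕ → ℕ → List (ℕ × Bool) → ℕ
mexSearch zero j l = j
mexSearch (suc f) j l = if occursNonOver j l then mexSearch f (j + 2) l else j

mex21 : List (ℕ × Bool) → ℕ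
mex21 l = mexSearch (length l) 1 l

mexCond : ℕ → List (ℕ × Bool) → Bool
mexCond k l = ((2 * k + 1) ≤ᵇ mex21 l) ∧ ((mex21 l % 4) ≡ᵇ ((2 * k + 1) % 4))

OP21 : ℕ → ℕ → Set
OP21 n k = Σ (List (ℕ × Bool)) (λ l → T (validOP l ∧ (size l ≡ᵇ n) ∧ mexCond k l))

HasSize : Set → ℕ → Set
HasSize A c = Fin c ↔ A

{-# OPTIONS --safe #-}

-- Removing one plain copy of each of 1, 3, …, 2m-1 shows that p̄(n - m²)
-- overpartitions of n have mex at least 2m+1.  Hence the signed count
-- Σ_π (-1)^((mex π - 1)/2) equals p̄(n) + 2 Σ_{m≥1} (-1)^m p̄(n - m²), which
-- vanishes for n ≥ 1 by Gauss's theta identity; the classes mex ≡ 1 and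
-- mex ≡ 3 (mod 4) are therefore equinumerous.  Gauss's identity is obtained from
-- a finite form due to Shanks: if c_k is the generating function of
-- overpartitions with parts at most k, then
--   c_n Σ_{|m|≤n} (-1)^m q^(m²) = c_0 + Σ_{s=1}^{n} (-1)^s q^(s(n+1)) (c_s + c_{s-1}),
-- whose right-hand side has no terms in q, …, q^n.
module Submission where

open import Defs
open import Data.Bool using (Bool; true; false; T; _∧_; _∨_; not; if_then_else_)
open import Data.Bool.Properties using (T-irrelevant; T-∧; ∧-zeroʳ; ∧-identityʳ; ∧-assoc; ¬-not; T?; T-≡)
open import Data.Fin using (Fin; zero; suc; toℕ)
import Data.Fin.Properties as Finₚ
open import Data.Integer as ℤ using (ℤ; 0ℤ; 1ℤ) renaming (+_ to pos)
import Data.Integer.Properties as ℤₚ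
import Data.Integer.Tactic.RingSolver as ℤ-Solver
open import Data.List using (List; []; _∷_; _++_; map; filter; length; lookup)
open import Data.List.Properties using (length-++; length-map; filter-++; filter-none; ∷-injectiveʳ)
open import Data.List.Membership.Propositional using (_∈_)
open import Data.List.Membership.Propositional.Properties
open import Data.List.Relation.Binary.Disjoint.Propositional using (Disjoint)
open import Data.List.Relation.Unary.All as All using (All)
open import Data.List.Relation.Unary.Any using (here; there; index)
open import Data.List.Relation.Unary.Any.Properties using (lookup-index)
open import Data.List.Relation.Unary.Unique.Propositional using (Unique)
import Data.List.Relation.Unary.AllPairs as AllPairs
import Data.List.Relation.Unary.Unique.Propositional.Properties as Unique
open import Data.Nat using (ℕ; zero; suc; _+_; _*_; _≤_; _<_; _≤′_; ≤′-refl; ≤′-step; _≤ᵇ_; _<ᵇ_; _≡ᵇ_; _%_; z≤n; s≤s)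
open import Data.Nat.DivMod using ([m+n]%n≡m%n)
open import Data.Nat.Properties
import Data.Nat.Tactic.RingSolver as ℕ-Solver
open import Data.Product using (Σ; _×_; _,_; proj₁; ∃-syntax)
open import Data.Product.Properties using (,-injectiveˡ)
open import Data.Sum using (inj₁; inj₂)
open import Function using (_∘_; _⇔_; mk⇔; mk↔ₛ′; Equivalence)
open import Relation.Nullary using (¬_; yes; no; contradiction)
open import Relation.Binary.PropositionalEquality

-- Shanks's finite form of Gauss's theta identity

ε : ℕ → ℤ
ε zero    = 1ℤ
ε (suc m) = ℤ.- ε m

2ℤ : ℤ
2ℤ = pos 2

-- c k a stands for the coefficient of q^N in q^a c_k, so that multiplying by a
-- power of q only moves the argument a; D n n and R n are the two sides of the
-- finite identity.
module Shanks
  (c : ℕ → ℕ → ℤ)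
  (c-rec : ∀ k a → c (suc k) a ≡ c (suc k) (a + suc k) ℤ.+ c k a ℤ.+ c k (a + suc k))
  (N : ℕ)
  (c-vanish : ∀ k a → N < a → c k a ≡ 0ℤ)
  where

  c-rec′ : ∀ k a {b} → b ≡ a + suc k → c (suc k) a ≡ c (suc k) b ℤ.+ c k a ℤ.+ c k b
  c-rec′ k a refl = c-rec k a

  D : ℕ → ℕ → ℕ → ℤ
  D k zero    a = c k a
  D k (suc m) a = D k m a ℤ.+ 2ℤ ℤ.* (ε (suc m) ℤ.* c k (a + suc m * suc m))

  -- The exponent step `p` is independent of the upper limit `s` because `Q-telescope` compares the
  -- steps `suc p` and `p` at the same upper limit.
  Q : ℕ → ℕ → ℕ → ℤ
  Q zero    p a = 0ℤ
  Q (suc s) p a = Q s p a ℤ.+ ε (suc s) ℤ.* (c (suc s) (a + suc s * p) ℤ.+ c s (a + suc s * p))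

  R : ℕ → ℕ → ℤ
  R n a = c 0 a ℤ.+ Q n (suc n) a

  -- Holds termwise: `D k m` is a combination of shifts of `c k` whose coefficients do not depend on
  -- `k`, so it inherits `c-rec`.
  D-rec : ∀ k m a → D (suc k) m a ≡ D (suc k) m (a + suc k) ℤ.+ D k m a ℤ.+ D k m (a + suc k)
  D-rec k zero    a = c-rec k a
  D-rec k (suc m) a = algebra (ε (suc m))
    (D (suc k) m b) (D k m a) (D k m b) (c (suc k) (b + j)) (c k (a + j)) (c k (b + j))
    (D-rec k m a) (c-rec′ k (a + j) (shift a (suc k) j))
    where
    b = a + suc k
    j = suc m * suc m
    shift : ∀ a k j → a + k + j ≡ a + j + k
    shift = ℕ-Solver.solve-∀
    algebra : ∀ e d₁ d₂ d₃ x₁ x₂ x₃ {d x} → d ≡ d₁ ℤ.+ d₂ ℤ.+ d₃ → x ≡ x₁ ℤ.+ x₂ ℤ.+ x₃ →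
      d ℤ.+ 2ℤ ℤ.* (e ℤ.* x) ≡ d₁ ℤ.+ 2ℤ ℤ.* (e ℤ.* x₁) ℤ.+ (d₂ ℤ.+ 2ℤ ℤ.* (e ℤ.* x₂)) ℤ.+ (d₃ ℤ.+ 2ℤ ℤ.* (e ℤ.* x₃))
    algebra e d₁ d₂ d₃ x₁ x₂ x₃ refl refl =
      ℤ-Solver.solve (e ∷ d₁ ∷ d₂ ∷ d₃ ∷ x₁ ∷ x₂ ∷ x₃ ∷ [])

  -- As series, (1 - q^p) Q t (p+1) - (1 + q^p) Q t p telescopes. By `c-rec`, q^s (c_s + c_{s-1}) =
  -- c_s - c_{s-1}, so its s-th term is T_s - T_{s-1} with T_s = 2 (-1)^(s+1) q^((s+1)p) c_s. The
  -- last two summands on the right are -T_0 and T_t.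
  Q-telescope : ∀ t p a →
    Q t (suc p) a ≡ Q t (suc p) (a + p) ℤ.+ Q t p a ℤ.+ Q t p (a + p)
                    ℤ.+ 2ℤ ℤ.* c 0 (a + p) ℤ.+ 2ℤ ℤ.* (ε (suc t) ℤ.* c t (a + suc t * p))
  Q-telescope zero p a rewrite +-identityʳ p = algebra (c 0 (a + p))
    where
    algebra : ∀ x → 0ℤ ≡ 0ℤ ℤ.+ 0ℤ ℤ.+ 0ℤ ℤ.+ 2ℤ ℤ.* x ℤ.+ 2ℤ ℤ.* (ℤ.- 1ℤ ℤ.* x)
    algebra x = ℤ-Solver.solve (x ∷ [])
  Q-telescope (suc t) p a rewrite sym (+-assoc a p (suc t * p)) =
    algebra (ε s) (Q t (suc p) b) (Q t p a) (Q t p b) (c 0 b)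
      (c s x′) (c t x) (c t x′) (c s y′) (c t y) (c t y′)
      (Q-telescope t p a) (c-rec′ t x (shift₁ a t p)) (c-rec′ t y (shift₂ a t p))
    where
    s = suc t
    b = a + p
    x = a + s * p
    x′ = a + s * suc p
    y = b + s * p
    y′ = b + s * suc p
    shift₁ : ∀ a t p → a + suc t * suc p ≡ a + suc t * p + suc t
    shift₁ = ℕ-Solver.solve-∀
    shift₂ : ∀ a t p → a + p + suc t * suc p ≡ a + p + suc t * p + suc t
    shift₂ = ℕ-Solver.solve-∀
    algebra : ∀ e q₁ q₂ q₃ z sx′ tx tx′ sy′ ty ty′ {q sx sy} →
      q ≡ q₁ ℤ.+ q₂ ℤ.+ q₃ ℤ.+ 2ℤ ℤ.* z ℤ.+ 2ℤ ℤ.* (e ℤ.* tx) →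
      sx ≡ sx′ ℤ.+ tx ℤ.+ tx′ → sy ≡ sy′ ℤ.+ ty ℤ.+ ty′ →
      q ℤ.+ e ℤ.* (sx′ ℤ.+ tx′) ≡ q₁ ℤ.+ e ℤ.* (sy′ ℤ.+ ty′) ℤ.+ (q₂ ℤ.+ e ℤ.* (sx ℤ.+ tx)) ℤ.+ (q₃ ℤ.+ e ℤ.* (sy ℤ.+ ty))
                            ℤ.+ 2ℤ ℤ.* z ℤ.+ 2ℤ ℤ.* (ℤ.- e ℤ.* sy)
    algebra e q₁ q₂ q₃ z sx′ tx tx′ sy′ ty ty′ refl refl refl =
      ℤ-Solver.solve (e ∷ q₁ ∷ q₂ ∷ q₃ ∷ z ∷ sx′ ∷ tx ∷ tx′ ∷ sy′ ∷ ty ∷ ty′ ∷ [])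

  pronic : ∀ a p → a + p * suc p ≡ a + p + p * p
  pronic = ℕ-Solver.solve-∀

  -- This is `D-rec t p` with `R` for `D`, after `D t p` is unfolded to `D t t` plus one term. The
  -- first extra term is the boundary term of `Q-telescope`; the second comes from `c-rec` applied
  -- to the top summand of `Q p (suc p)`, whose exponent p(p+1) equals p + p².
  R-rec : ∀ t a → let p = suc t in
    R p a ≡ R p (a + p) ℤ.+ (R t a ℤ.+ 2ℤ ℤ.* (ε p ℤ.* c t (a + p * p)))
            ℤ.+ (R t (a + p) ℤ.+ 2ℤ ℤ.* (ε p ℤ.* c t (a + p + p * p)))
  R-rec t a rewrite pronic a (suc t) =
    algebra (ε p) (c 0 a) (Q t (suc p) b) (Q t p a) (Q t p b) (c 0 b)
      (c t (a + p * p)) (c p v) (c t u) (c t v)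
      (Q-telescope t p a) (c-rec′ t u (shift a p))
    where
    p = suc t
    b = a + p
    u = b + p * p
    v = b + p * suc p
    shift : ∀ a p → a + p + p * suc p ≡ a + p + p * p + p
    shift = ℕ-Solver.solve-∀
    algebra : ∀ e z q₁ q₂ q₃ z′ x pv tu tv {q pu} →
      q ≡ q₁ ℤ.+ q₂ ℤ.+ q₃ ℤ.+ 2ℤ ℤ.* z′ ℤ.+ 2ℤ ℤ.* (e ℤ.* x) → pu ≡ pv ℤ.+ tu ℤ.+ tv →
      z ℤ.+ (q ℤ.+ e ℤ.* (pu ℤ.+ tu)) ≡ z′ ℤ.+ (q₁ ℤ.+ e ℤ.* (pv ℤ.+ tv)) ℤ.+ (z ℤ.+ q₂ ℤ.+ 2ℤ ℤ.* (e ℤ.* x))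
                                ℤ.+ (z′ ℤ.+ q₃ ℤ.+ 2ℤ ℤ.* (e ℤ.* tu))
    algebra e z q₁ q₂ q₃ z′ x pv tu tv refl refl =
      ℤ-Solver.solve (e ∷ z ∷ q₁ ∷ q₂ ∷ q₃ ∷ z′ ∷ x ∷ pv ∷ tu ∷ tv ∷ [])

  D-vanish : ∀ k m a → N < a → D k m a ≡ 0ℤ
  D-vanish k zero    a N<a = c-vanish k a N<a
  D-vanish k (suc m) a N<a
    rewrite D-vanish k m a N<a
          | c-vanish k (a + suc m * suc m) (m≤n⇒m≤n+o _ N<a)
          | ℤₚ.*-zeroʳ (ε (suc m)) = refl

  Q-vanish : ∀ t p a → N < a + p → Q t p a ≡ 0ℤ
  Q-vanish zero    p a N<a+p = refl
  Q-vanish (suc t) p a N<a+p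
    rewrite Q-vanish t p a N<a+p
          | c-vanish (suc t) (a + suc t * p) (<-≤-trans N<a+p (+-monoʳ-≤ a (m≤m+n p (t * p))))
          | c-vanish t (a + suc t * p) (<-≤-trans N<a+p (+-monoʳ-≤ a (m≤m+n p (t * p))))
          | ℤₚ.*-zeroʳ (ε (suc t)) = refl

  R-vanish : ∀ n a → N < a → R n a ≡ 0ℤ
  R-vanish n a N<a rewrite c-vanish 0 a N<a | Q-vanish n (suc n) a (m≤n⇒m≤n+o _ N<a) = refl

  -- Both sides satisfy (1 - q^p) x_p = (1 + q^p) x_{p-1} + (the same term), and
  -- 1 - q^p can be cancelled because everything vanishes for a > N.
  D≡R : ∀ n a → D n n a ≡ R n a
  D≡R zero    a = sym (ℤₚ.+-identityʳ (c 0 a))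
  D≡R (suc t) a = go (suc N) a (m≤n+m (suc N) a)
    where
    p = suc t
    -- Each use of the recurrence raises `a` by p ≥ 1, so fuel `suc N` carries it past `N`.
    go : ∀ f a → N < a + f → D p p a ≡ R p a
    go zero    a N<a+f = trans (D-vanish p p a N<a) (sym (R-vanish p a N<a))
      where N<a = subst (N <_) (+-identityʳ a) N<a+f
    go (suc f) a N<a+f = trans (D-rec t p a) (trans
      (cong₂ ℤ._+_ (cong₂ ℤ._+_ (go f (a + p) N<a+p+f) (cong (ℤ._+ _) (D≡R t a)))
                 (cong (ℤ._+ _) (D≡R t (a + p))))
      (sym (R-rec t a)))
      where
      N<a+p+f : N < a + p + f
      N<a+p+f = <-≤-trans N<a+f (≤-trans (+-monoʳ-≤ a (s≤s (m≤n+m f t)))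
                                               (≤-reflexive (sym (+-assoc a p f))))

  -- For N ≤ n every exponent s(n+1) in `Q` exceeds N, which leaves only `c 0 0` in `R n 0`.
  gauss : ∀ n → N ≤ n → c 0 0 ≡ 0ℤ → D n n 0 ≡ 0ℤ
  gauss n N≤n c00≡0 rewrite D≡R n 0 | c00≡0 | Q-vanish n (suc n) 0 (s≤s N≤n) = refl

-- Enumeration of overpartitions with bounded parts

Parts : Set
Parts = List (ℕ × Bool)

private variable
  k : ℕ
  l : Parts

-- An overlined part is the last of its size, so the tail drops to bound `k`; after a plain part the
-- same size may recur.
data Bounded : ℕ → Parts → Set where
  none       : Bounded zero []
  weaken     : Bounded k l → Bounded (suc k) l
  overlined  : Bounded k l → Bounded (suc k) ((suc k , true) ∷ l)
  plain      : Bounded (suc k) l → Bounded (suc k) ((suc k , false) ∷ l)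

-- enum k a n lists the overpartitions of n - a with parts at most k (none if
-- n < a).  Carrying a separately avoids truncated subtraction and makes the
-- recursion structural.
enum : ℕ → ℕ → ℕ → List Parts
enum k       (suc a) zero    = []
enum k       (suc a) (suc n) = enum k a n
enum zero    zero    zero    = [] ∷ []
enum zero    zero    (suc n) = []
enum (suc k) zero    zero    = enum k zero zero
-- Taking a part `suc k` from `suc n` leaves n - k, hence the shift `k` at total `n`.
enum (suc k) zero    (suc n) =
  enum k zero (suc n) ++ map ((suc k , true) ∷_) (enum k k n)
                      ++ map ((suc k , false) ∷_) (enum (suc k) k n)

enum-vanish : ∀ k {a n} → n < a → enum k a n ≡ []
enum-vanish k {suc a} {zero}  n<a       = refl
enum-vanish k {suc a} {suc n} (s≤s n<a) = enum-vanish k n<a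

enum-sound : ∀ k a n {l} → l ∈ enum k a n → Bounded k l × a + size l ≡ n
enum-sound k (suc a) (suc n) l∈ with enum-sound k a n l∈
... | b , eq = b , cong suc eq
enum-sound zero zero zero (here refl) = none , refl
enum-sound (suc k) zero zero l∈ with enum-sound k zero zero l∈
... | b , eq = weaken b , eq
enum-sound (suc k) zero (suc n) l∈ with ∈-++⁻ (enum k zero (suc n)) l∈
... | inj₁ l∈₁ with enum-sound k zero (suc n) l∈₁
...   | b , eq = weaken b , eq
enum-sound (suc k) zero (suc n) l∈ | inj₂ l∈′ with ∈-++⁻ (map ((suc k , true) ∷_) (enum k k n)) l∈′
... | inj₁ l∈₂ with ∈-map⁻ _ l∈₂
...   | l′ , l′∈ , refl with enum-sound k k n l′∈
...     | b , eq = overlined b , cong suc eq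
enum-sound (suc k) zero (suc n) l∈ | inj₂ l∈′ | inj₂ l∈₃ with ∈-map⁻ _ l∈₃
...   | l′ , l′∈ , refl with enum-sound (suc k) k n l′∈
...     | b , eq = plain b , cong suc eq

enum-shift : ∀ k a n → enum k a (a + n) ≡ enum k 0 n
enum-shift k zero    n = refl
enum-shift k (suc a) n = enum-shift k a n

enum-complete : Bounded k l → l ∈ enum k 0 (size l)
enum-complete none = here refl
enum-complete {suc k} {l} (weaken b) = widen (size l) (enum-complete b)
  where
  widen : ∀ n → l ∈ enum k 0 n → l ∈ enum (suc k) 0 n
  widen zero    l∈ = l∈
  widen (suc n) l∈ = ∈-++⁺ˡ l∈
enum-complete {suc k} {_ ∷ l} (overlined b) =
  ∈-++⁺ʳ (enum k 0 (suc k + size l)) (∈-++⁺ˡ (∈-map⁺ _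
    (subst (l ∈_) (sym (enum-shift k k (size l))) (enum-complete b))))
enum-complete {suc k} {_ ∷ l} (plain b) =
  ∈-++⁺ʳ (enum k 0 (suc k + size l)) (∈-++⁺ʳ (map _ (enum k k (k + size l))) (∈-map⁺ _
    (subst (l ∈_) (sym (enum-shift (suc k) k (size l))) (enum-complete b))))

Bounded-head : ∀ {a o} → Bounded k ((a , o) ∷ l) → a ≤ k
Bounded-head (weaken b)    = m≤n⇒m≤1+n (Bounded-head b)
Bounded-head (overlined b) = ≤-refl
Bounded-head (plain b)     = ≤-refl

-- The three sublists are disjoint: a list in the first cannot start with `suc k`, and the other two
-- differ in the flag of their first part.
enum-unique : ∀ k a n → Unique (enum k a n)
enum-unique k       (suc a) zero    = AllPairs.[]
enum-unique k       (suc a) (suc n) = enum-unique k a n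
enum-unique zero    zero    zero    = All.[] AllPairs.∷ AllPairs.[]
enum-unique zero    zero    (suc n) = AllPairs.[]
enum-unique (suc k) zero    zero    = enum-unique k zero zero
enum-unique (suc k) zero    (suc n) =
  Unique.++⁺ (enum-unique k zero (suc n))
    (Unique.++⁺ (Unique.map⁺ ∷-injectiveʳ (enum-unique k k n))
                (Unique.map⁺ ∷-injectiveʳ (enum-unique (suc k) k n))
                overlined≢plain)
    smaller≢new
  where
  overlined≢plain : Disjoint (map ((suc k , true) ∷_) (enum k k n)) (map ((suc k , false) ∷_) (enum (suc k) k n))
  overlined≢plain (l∈₁ , l∈₂) with ∈-map⁻ _ l∈₁ | ∈-map⁻ _ l∈₂
  ... | _ , _ , refl | _ , _ , ()
  not-smaller : ∀ {o l} → ¬ ((suc k , o) ∷ l ∈ enum k zero (suc n))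
  not-smaller l∈ = 1+n≰n (Bounded-head (proj₁ (enum-sound k zero (suc n) l∈)))
  smaller≢new : Disjoint (enum k zero (suc n)) (map ((suc k , true) ∷_) (enum k k n) ++ map ((suc k , false) ∷_) (enum (suc k) k n))
  smaller≢new (l∈ , l∈′) with ∈-++⁻ (map ((suc k , true) ∷_) (enum k k n)) l∈′
  ... | inj₁ l∈₁ with ∈-map⁻ _ l∈₁
  ...   | _ , _ , refl = not-smaller l∈
  smaller≢new (l∈ , l∈′) | inj₂ l∈₂ with ∈-map⁻ _ l∈₂
  ...   | _ , _ , refl = not-smaller l∈

Bounded-mono : ∀ {k k′} → k ≤ k′ → Bounded k l → Bounded k′ l
Bounded-mono k≤k′ b = go (≤⇒≤′ k≤k′)
  where
  go : ∀ {k′} → _ ≤′ k′ → Bounded k′ _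
  go ≤′-refl         = b
  go (≤′-step k≤′k′) = weaken (go k≤′k′)

Bounded⇒valid : Bounded k l → T (validOP l)
Bounded⇒valid none = _
Bounded⇒valid (weaken b) = Bounded⇒valid b
Bounded⇒valid {l = _ ∷ []} (overlined b) = _
Bounded⇒valid {l = _ ∷ []} (plain b) = _
Bounded⇒valid {l = (a , _) ∷ _ ∷ _} (overlined b) =
  Equivalence.from T-∧ (≤⇒≤ᵇ (m≤n⇒m≤1+n (Bounded-head b)) ,
    Equivalence.from T-∧ (<⇒<ᵇ (s≤s (Bounded-head b)) , Bounded⇒valid b))
Bounded⇒valid {l = _ ∷ _ ∷ _} (plain b) =
  Equivalence.from T-∧ (≤⇒≤ᵇ (Bounded-head b) , Bounded⇒valid b)

-- `validOP` tests positivity only at the last part. A zero further left forces a zero behind it,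
-- which `positive` rules out by induction.
valid⇒Bounded : ∀ a o l → T (validOP ((a , o) ∷ l)) → Bounded a ((a , o) ∷ l)
valid⇒Bounded (suc a) true  [] v = overlined (Bounded-mono z≤n none)
valid⇒Bounded (suc a) false [] v = plain (Bounded-mono z≤n none)
valid⇒Bounded a o ((a′ , o′) ∷ l) v with Equivalence.to T-∧ v
... | a′≤a , v′ with Equivalence.to (T-∧ {not o ∨ (a′ <ᵇ a)}) v′
...   | strict , v″ = go a o (≤ᵇ⇒≤ a′ a a′≤a) strict (valid⇒Bounded a′ o′ l v″)
  where
  positive : ∀ {k o l} → ¬ Bounded k ((0 , o) ∷ l)
  positive (weaken b) = positive b
  go : ∀ a o → a′ ≤ a → T (not o ∨ (a′ <ᵇ a)) → Bounded a′ ((a′ , o′) ∷ l) → Bounded a ((a , o) ∷ (a′ , o′) ∷ l)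
  go zero    o     z≤n  s b = contradiction b positive
  go (suc a) true  a′≤a s b = overlined (Bounded-mono (≤-pred (<ᵇ⇒< a′ (suc a) s)) b)
  go (suc a) false a′≤a s b = plain (Bounded-mono a′≤a b)

-- Bounding the parts by `n` loses nothing, since the first part is the largest and is at most the
-- size.
∈-enum⇔ : ∀ n l → l ∈ enum n 0 n ⇔ T (validOP l ∧ (size l ≡ᵇ n))
∈-enum⇔ n l = mk⇔ to from
  where
  to : l ∈ enum n 0 n → T (validOP l ∧ (size l ≡ᵇ n))
  to l∈ with enum-sound n 0 n l∈
  ... | b , eq = Equivalence.from T-∧ (Bounded⇒valid b , ≡⇒≡ᵇ (size l) n eq)
  bounded : ∀ l → T (validOP l) → Bounded (size l) l
  bounded []            v = none
  bounded ((a , o) ∷ l) v = Bounded-mono (m≤m+n a (size l)) (valid⇒Bounded a o l v)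
  from : T (validOP l ∧ (size l ≡ᵇ n)) → l ∈ enum n 0 n
  from p with Equivalence.to (T-∧ {validOP l}) p
  ... | v , s with ≡ᵇ⇒≡ (size l) n s
  ...   | refl = enum-complete (bounded l v)

-- Cardinalities and counting over lists

lookup-injective : ∀ {A : Set} {xs : List A} → Unique xs → ∀ i j → lookup xs i ≡ lookup xs j → i ≡ j
lookup-injective (_   AllPairs.∷ _) zero    zero    _  = refl
lookup-injective (x∉ AllPairs.∷ _) zero    (suc j) eq = contradiction eq (All.lookup x∉ (∈-lookup j))
lookup-injective (x∉ AllPairs.∷ _) (suc i) zero    eq = contradiction (sym eq) (All.lookup x∉ (∈-lookup i))
lookup-injective (_   AllPairs.∷ u) (suc i) (suc j) eq = cong suc (lookup-injective u i j eq)

list-hasSize : {A : Set} (xs : List A) → Unique xs → (P : A → Bool) → (∀ x → x ∈ xs ⇔ T (P x)) →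
  HasSize (Σ A (T ∘ P)) (length xs)
list-hasSize {A} xs u P ∈⇔ = mk↔ₛ′
  (λ i → lookup xs i , Equivalence.to (∈⇔ _) (∈-lookup i))
  (λ (l , p) → index (Equivalence.from (∈⇔ l) p))
  (λ (l , p) → Σ-≡ (sym (lookup-index (Equivalence.from (∈⇔ l) p))))
  (λ i → lookup-injective u _ _ (sym (lookup-index (Equivalence.from (∈⇔ _) _))))
  where
  Σ-≡ : ∀ {l l′ p p′} → l ≡ l′ → _≡_ {A = Σ A (T ∘ P)} (l , p) (l′ , p′)
  Σ-≡ {p = p} {p′} refl = cong (_ ,_) (T-irrelevant p p′)

count : (Parts → Bool) → List Parts → ℕ
count p xs = length (filter (T? ∘ p) xs)

count-++ : ∀ p xs ys → count p (xs ++ ys) ≡ count p xs + count p ys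
count-++ p xs ys = trans (cong length (filter-++ (T? ∘ p) xs ys)) (length-++ (filter (T? ∘ p) xs))

count-map : ∀ {p q} {f : Parts → Parts} → (∀ l → p (f l) ≡ q l) → ∀ xs → count p (map f xs) ≡ count q xs
count-map pf≡q [] = refl
count-map {p} {q} {f} pf≡q (l ∷ xs) with p (f l) | q l | pf≡q l
... | true  | _ | refl = cong suc (count-map pf≡q xs)
... | false | _ | refl = count-map pf≡q xs

count-none : ∀ {p} xs → (∀ {l} → l ∈ xs → p l ≡ false) → count p xs ≡ 0
count-none {p} xs p≡false = cong length (filter-none (T? ∘ p) (All.tabulate (λ l∈ → subst T (p≡false l∈))))

-- The summands correspond to first part a plain `suc k`, no part `suc k`, and first part an
-- overlined `suc k`. This is (1 - q^(k+1)) c_{k+1} = (1 + q^(k+1)) c_k, the hypothesis `c-rec` of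
-- `Shanks`.
length-enum-rec : ∀ k a n →
  length (enum (suc k) a n) ≡
  length (enum (suc k) (a + suc k) n) + length (enum k a n) + length (enum k (a + suc k) n)
length-enum-rec k zero    zero    = sym (+-identityʳ _)
length-enum-rec k (suc a) zero    = refl
length-enum-rec k (suc a) (suc n) = length-enum-rec k a n
length-enum-rec k zero    (suc n) = begin
  length (xs ++ map _ ys ++ map _ zs)                 ≡⟨ length-++ xs ⟩
  length xs + length (map _ ys ++ map _ zs)           ≡⟨ cong (length xs +_) (length-++ (map _ ys)) ⟩
  length xs + (length (map _ ys) + length (map _ zs)) ≡⟨ cong (length xs +_) (cong₂ _+_ (length-map _ ys) (length-map _ zs)) ⟩
  length xs + (length ys + length zs)                 ≡⟨ rotate (length xs) (length ys) (length zs) ⟩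
  length zs + length xs + length ys                   ∎
  where
  open ≡-Reasoning
  xs = enum k 0 (suc n)
  ys = enum k k n
  zs = enum (suc k) k n
  rotate : ∀ x y z → x + (y + z) ≡ z + x + y
  rotate = ℕ-Solver.solve-∀

-- Overpartitions containing the first m odd numbers as plain parts

-- hasOdds m l: each of 1, 3, …, 2m-1 occurs plain in l, i.e. mex ≥ 2m+1.
hasOdds : ℕ → Parts → Bool
hasOdds zero    l = true
hasOdds (suc m) l = hasOdds m l ∧ occursNonOver (suc (2 * m)) l

≢⇒≡ᵇ-false : ∀ {a j} → a ≢ j → (a ≡ᵇ j) ≡ false
≢⇒≡ᵇ-false {a} {j} a≢j with a ≡ᵇ j in eq
... | false = refl
... | true  = contradiction (≡ᵇ⇒≡ a j (subst T (sym eq) _)) a≢j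

occurs-∷-≢ : ∀ {a o j l} → a ≢ j → occursNonOver j ((a , o) ∷ l) ≡ occursNonOver j l
occurs-∷-≢ {o = o} a≢j rewrite ≢⇒≡ᵇ-false a≢j | ∧-zeroʳ (not o) = refl

occurs-> : ∀ {j} → Bounded k l → k < j → occursNonOver j l ≡ false
occurs-> none          k<j = refl
occurs-> (weaken b)    k<j = occurs-> b (<-trans (n<1+n _) k<j)
occurs-> (overlined b) k<j = occurs-> b (<-trans (n<1+n _) k<j)
occurs-> {l = _ ∷ l} (plain b) k<j = trans (occurs-∷-≢ {o = false} {l = l} (<⇒≢ k<j)) (occurs-> b k<j)

hasOdds-∷ : ∀ m {a o} → 2 * m ≤ a → ∀ l → hasOdds m ((a , o) ∷ l) ≡ hasOdds m l
hasOdds-∷ zero    2m≤a l = refl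
hasOdds-∷ (suc m) {a} {o} 2+2m≤a l = cong₂ _∧_
  (hasOdds-∷ m (≤-trans (n≤1+n _) 2m<a) l)
  (occurs-∷-≢ {o = o} {l = l} (≢-sym (<⇒≢ 1+2m<a)))
  where
  1+2m<a : suc (2 * m) < a
  1+2m<a = subst (_≤ a) (*-suc 2 m) 2+2m≤a
  2m<a : 2 * m < a
  2m<a = <-trans (n<1+n _) 1+2m<a

hasOdds-> : ∀ m → Bounded k l → k ≤ 2 * m → hasOdds (suc m) l ≡ false
hasOdds-> {l = l} m b k≤2m = trans (cong (hasOdds m l ∧_) (occurs-> b (s≤s k≤2m))) (∧-zeroʳ _)

count-hasOdds-> : ∀ m k a n → k ≤ 2 * m → count (hasOdds (suc m)) (enum k a n) ≡ 0
count-hasOdds-> m k a n k≤2m = count-none (enum k a n) λ l∈ → hasOdds-> m (proj₁ (enum-sound k a n l∈)) k≤2m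

count-enum-rec : ∀ p k n → count p (enum (suc k) 0 (suc n)) ≡
  count p (enum k 0 (suc n)) + (count p (map ((suc k , true) ∷_) (enum k k n))
                                + count p (map ((suc k , false) ∷_) (enum (suc k) k n)))
count-enum-rec p k n = trans (count-++ p (enum k 0 (suc n)) _)
  (cong (count p (enum k 0 (suc n)) +_) (count-++ p (map _ (enum k k n)) _))

enum-zero : ∀ k → enum k 0 0 ≡ [] ∷ []
enum-zero zero    = refl
enum-zero (suc k) = enum-zero k

-- The removal of 1, 3, ..., 2m-1 is done by induction along `enum`, largest part first. The
-- hypothesis says that 2m-1 is an admissible part size.
count-hasOdds : ∀ m k a n → 2 * m ≤ suc k →
  count (hasOdds m) (enum k a n) ≡ length (enum k (a + m * m) n)
count-hasOdds zero k a n _ rewrite +-identityʳ a = count-all (enum k a n)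
  where
  count-all : ∀ xs → count (hasOdds 0) xs ≡ length xs
  count-all []       = refl
  count-all (x ∷ xs) = cong suc (count-all xs)
count-hasOdds (suc m) k       (suc a) zero    _ = refl
count-hasOdds (suc m) k       (suc a) (suc n) h = count-hasOdds (suc m) k a n h
count-hasOdds (suc m) zero    zero    n       h = contradiction (subst (_≤ 1) (*-suc 2 m) h) λ { (s≤s ()) }
count-hasOdds (suc m) (suc k) zero    zero    h
  rewrite enum-zero k | ∧-zeroʳ (hasOdds m []) = refl
count-hasOdds (suc m) (suc k) zero    (suc n) h with m≤n⇒m<n∨m≡n h
-- Here `suc k` exceeds 2m+1, so prepending it does not affect `χ`, and the three counts recombine
-- by `length-enum-rec`.
... | inj₁ (s≤s h′) = begin
  count χ (enum (suc k) 0 (suc n))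
    ≡⟨ count-enum-rec χ k n ⟩
  count χ (enum k 0 (suc n)) + (count χ (map _ (enum k k n)) + count χ (map _ (enum (suc k) k n)))
    ≡⟨ cong (count χ (enum k 0 (suc n)) +_) (cong₂ _+_
         (count-map {p = χ} {f = (suc k , true) ∷_} (hasOdds-∷ (suc m) h′) (enum k k n))
         (count-map {p = χ} {f = (suc k , false) ∷_} (hasOdds-∷ (suc m) h′) (enum (suc k) k n))) ⟩
  count χ (enum k 0 (suc n)) + (count χ (enum k k n) + count χ (enum (suc k) k n))
    ≡⟨ cong₂ _+_ (count-hasOdds (suc m) k 0 (suc n) h′) (cong₂ _+_
         (count-hasOdds (suc m) k k n h′) (count-hasOdds (suc m) (suc k) k n h)) ⟩
  length (enum k j (suc n)) + (length (enum k (suc k + j) (suc n)) + length (enum (suc k) (suc k + j) (suc n)))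
    ≡⟨ cong (λ i → length (enum k j (suc n)) + (length (enum k i (suc n)) + length (enum (suc k) i (suc n)))) (+-comm (suc k) j) ⟩
  length (enum k j (suc n)) + (length (enum k (j + suc k) (suc n)) + length (enum (suc k) (j + suc k) (suc n)))
    ≡⟨ rotate (length (enum k j (suc n))) (length (enum k (j + suc k) (suc n))) (length (enum (suc k) (j + suc k) (suc n))) ⟩
  length (enum (suc k) (j + suc k) (suc n)) + length (enum k j (suc n)) + length (enum k (j + suc k) (suc n))
    ≡⟨ length-enum-rec k j (suc n) ⟨
  length (enum (suc k) j (suc n)) ∎
  where
  open ≡-Reasoning
  χ = hasOdds (suc m)
  j = suc m * suc m
  rotate : ∀ x y z → x + (y + z) ≡ z + x + y
  rotate = ℕ-Solver.solve-∀
-- Here `suc k` is 2m+1, the largest odd number required. Only lists starting with a plain copy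
-- count; stripping it leaves `hasOdds m`, and m² + (2m+1) = (m+1)².
... | inj₂ eq with suc-injective (suc-injective (trans (sym (*-suc 2 m)) eq))
...   | refl = begin
  count χ (enum (suc k) 0 (suc n))
    ≡⟨ count-enum-rec χ k n ⟩
  count χ (enum k 0 (suc n)) + (count χ (map _ (enum k k n)) + count χ (map _ (enum (suc k) k n)))
    ≡⟨ cong₂ _+_ (count-hasOdds-> m k 0 (suc n) ≤-refl) (cong₂ _+_
         (trans (count-map {p = χ} {q = χ} {f = (suc k , true) ∷_} overlined-∷ (enum k k n))
                (count-hasOdds-> m k k n ≤-refl))
         (count-map {p = χ} {f = (suc k , false) ∷_} plain-∷ (enum (suc k) k n))) ⟩
  count (hasOdds m) (enum (suc k) k n)
    ≡⟨ count-hasOdds m (suc k) k n (≤-trans (n≤1+n _) (n≤1+n _)) ⟩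
  length (enum (suc k) (k + m * m) n)
    ≡⟨ cong (λ i → length (enum (suc k) i n)) (square m) ⟩
  length (enum (suc k) (m + m * suc m) n) ∎
  where
  open ≡-Reasoning
  χ = hasOdds (suc m)
  square : ∀ m → 2 * m + m * m ≡ m + m * suc m
  square = ℕ-Solver.solve-∀
  overlined-∷ : ∀ l → χ ((suc (2 * m) , true) ∷ l) ≡ χ l
  overlined-∷ l = cong (_∧ occursNonOver (suc (2 * m)) l) (hasOdds-∷ m (n≤1+n _) l)
  plain-∷ : ∀ l → χ ((suc (2 * m) , false) ∷ l) ≡ hasOdds m l
  plain-∷ l rewrite Equivalence.to T-≡ (≡⇒≡ᵇ (2 * m) (2 * m) refl) =
    trans (∧-identityʳ _) (hasOdds-∷ m (n≤1+n _) l)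

-- Outside the range of `count-hasOdds`, 2m-1 > n; then m² > n as well, and both sides vanish.
count-hasOdds-enum : ∀ n m → count (hasOdds m) (enum n 0 n) ≡ length (enum n (m * m) n)
count-hasOdds-enum n m with 2 * m ≤? suc n
... | yes 2m≤1+n = count-hasOdds m n 0 n 2m≤1+n
... | no  2m≰1+n with m
...   | zero  = contradiction z≤n 2m≰1+n
...   | suc m = trans (count-hasOdds-> m n 0 n n≤2m) (cong length (sym (enum-vanish n n<square)))
  where
  n≤2m : n ≤ 2 * m
  n≤2m = ≤-pred (≤-pred (subst (suc n <_) (*-suc 2 m) (≰⇒> 2m≰1+n)))
  square : ∀ m → suc m * suc m ≡ suc (2 * m + m * m)
  square = ℕ-Solver.solve-∀
  n<square : n < suc m * suc m
  n<square = subst (n <_) (sym (square m)) (s≤s (m≤n⇒m≤n+o (m * m) n≤2m))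

-- The mex and the initial run of odd plain parts

occurs⇒∈ : ∀ j l → occursNonOver j l ≡ true → (j , false) ∈ l
occurs⇒∈ j ((a , true)  ∷ l) occ = there (occurs⇒∈ j l occ)
occurs⇒∈ j ((a , false) ∷ l) occ with a ≡ᵇ j in eq
... | true  = here (cong (_, false) (sym (≡ᵇ⇒≡ a j (subst T (sym eq) _))))
... | false = there (occurs⇒∈ j l occ)

hasOdds-suc⁻ : ∀ m l → hasOdds (suc m) l ≡ true → hasOdds m l ≡ true
hasOdds-suc⁻ m l h with hasOdds m l
... | true = refl

hasOdds⇒occurs : ∀ m l → hasOdds m l ≡ true → ∀ {i} → i < m → occursNonOver (suc (2 * i)) l ≡ true
hasOdds⇒occurs (suc m) l h (s≤s i≤m) with m≤n⇒m<n∨m≡n i≤m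
... | inj₁ i<m  = hasOdds⇒occurs m l (hasOdds-suc⁻ m l h) i<m
... | inj₂ refl with hasOdds m l
...   | true = h

-- Pigeonhole: distinct odd parts sit at distinct positions.
hasOdds⇒≤length : ∀ m l → hasOdds m l ≡ true → m ≤ length l
hasOdds⇒≤length m l h = Finₚ.injective⇒≤ {f = index ∘ odd∈} λ {i} {j} eq →
  Finₚ.toℕ-injective (*-cancelˡ-≡ _ _ 2 (suc-injective (,-injectiveˡ
    (trans (lookup-index (odd∈ i)) (trans (cong (lookup l) eq) (sym (lookup-index (odd∈ j))))))))
  where
  odd∈ : (i : Fin m) → (suc (2 * toℕ i) , false) ∈ l
  odd∈ i = occurs⇒∈ _ l (hasOdds⇒occurs m l h (Finₚ.toℕ<n i))

next-odd : ∀ i → 2 * i + 1 + 2 ≡ 2 * suc i + 1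
next-odd = ℕ-Solver.solve-∀

-- The last component says that running out of fuel is the only reason to stop
-- at an odd number that occurs.
mexSearch-spec : ∀ f i l → hasOdds i l ≡ true →
  ∃[ m ] mexSearch f (2 * i + 1) l ≡ 2 * m + 1 × hasOdds m l ≡ true × (hasOdds (suc m) l ≡ true → m ≡ i + f)
mexSearch-spec zero    i l h = i , refl , h , λ _ → sym (+-identityʳ i)
mexSearch-spec (suc f) i l h with occursNonOver (2 * i + 1) l in occ
... | false = i , refl , h , λ h′ → contradiction
  (trans (sym (hasOdds⇒occurs (suc i) l h′ ≤-refl)) (trans (cong (λ j → occursNonOver j l) (+-comm 1 (2 * i))) occ))
  λ ()
... | true  rewrite next-odd i | +-suc i f = mexSearch-spec f (suc i) l
  (cong₂ _∧_ h (trans (cong (λ j → occursNonOver j l) (+-comm 1 (2 * i))) occ))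

-- Had the fuel run out at an occurring odd number, `l` would contain `suc (length l)` distinct odd
-- parts.
mex21-spec : ∀ l → ∃[ m ] mex21 l ≡ 2 * m + 1 × hasOdds m l ≡ true × hasOdds (suc m) l ≡ false
mex21-spec l with mexSearch-spec (length l) 0 l refl
... | m , eq , h , max = m , eq , h , ¬-not λ h′ →
  1+n≰n (subst (_≤ length l) (cong suc (max h′)) (hasOdds⇒≤length (suc m) l h′))

hasOdds-false-mono : ∀ {m} m′ l → m ≤ m′ → hasOdds m l ≡ false → hasOdds m′ l ≡ false
hasOdds-false-mono zero l z≤n ()
hasOdds-false-mono (suc m′) l m≤ h with m≤n⇒m<n∨m≡n m≤
... | inj₁ (s≤s m≤m′) rewrite hasOdds-false-mono m′ l m≤m′ h = refl
... | inj₂ refl = h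

hasOdds-true-mono : ∀ {m m′} l → m ≤ m′ → hasOdds m′ l ≡ true → hasOdds m l ≡ true
hasOdds-true-mono {m} l m≤m′ h with hasOdds m l in eq
... | true  = refl
... | false = trans (sym (hasOdds-false-mono _ l m≤m′ eq)) h

-- The signed count by mex

-- A list with mex 2μ+1 contributes 1 + 2 Σ_{1≤i≤min(M,μ)} (-1)^i = (-1)^min(M,μ), so for large `M`
-- this is the signed count. The form chosen matches `D` term by term.
alternating : ℕ → List Parts → ℤ
alternating zero    xs = pos (length xs)
alternating (suc m) xs = alternating m xs ℤ.+ 2ℤ ℤ.* (ε (suc m) ℤ.* pos (count (hasOdds (suc m)) xs))

alternating-[] : ∀ M → alternating M [] ≡ 0ℤ
alternating-[] zero    = refl
alternating-[] (suc M) = cong₂ (λ a x → a ℤ.+ 2ℤ ℤ.* x) (alternating-[] M) (ℤₚ.*-zeroʳ (ε (suc M)))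

alternating-∷ : ∀ M l xs → alternating M (l ∷ xs) ≡ alternating M (l ∷ []) ℤ.+ alternating M xs
alternating-∷ zero    l xs = refl
alternating-∷ (suc m) l xs = algebra (ε (suc m))
  (alternating m (l ∷ [])) (alternating m xs) (count (hasOdds (suc m)) (l ∷ [])) (count (hasOdds (suc m)) xs)
  (alternating-∷ m l xs) (count-++ (hasOdds (suc m)) (l ∷ []) xs)
  where
  distribute : ∀ e a b x y → a ℤ.+ b ℤ.+ 2ℤ ℤ.* (e ℤ.* (x ℤ.+ y)) ≡ a ℤ.+ 2ℤ ℤ.* (e ℤ.* x) ℤ.+ (b ℤ.+ 2ℤ ℤ.* (e ℤ.* y))
  distribute e a b x y = ℤ-Solver.solve (e ∷ a ∷ b ∷ x ∷ y ∷ [])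
  algebra : ∀ e a b x y {c z} → c ≡ a ℤ.+ b → z ≡ x + y →
    c ℤ.+ 2ℤ ℤ.* (e ℤ.* pos z) ≡ a ℤ.+ 2ℤ ℤ.* (e ℤ.* pos x) ℤ.+ (b ℤ.+ 2ℤ ℤ.* (e ℤ.* pos y))
  algebra e a b x y refl refl = distribute e a b (pos x) (pos y)

alternating-below : ∀ M {m} l → M ≤ m → hasOdds m l ≡ true → alternating M (l ∷ []) ≡ ε M
alternating-below zero    l M≤m h = refl
alternating-below (suc M) l M<m h
  rewrite alternating-below M l (<⇒≤ M<m) h | hasOdds-true-mono l M<m h = algebra (ε M)
  where
  algebra : ∀ e → e ℤ.+ 2ℤ ℤ.* ((ℤ.- e) ℤ.* 1ℤ) ≡ ℤ.- e
  algebra e = ℤ-Solver.solve (e ∷ [])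

alternating-above : ∀ {M m} l → m ≤ M → hasOdds m l ≡ true → hasOdds (suc m) l ≡ false → alternating M (l ∷ []) ≡ ε m
alternating-above {M} l m≤M h h′ with m≤n⇒m<n∨m≡n m≤M
... | inj₂ refl = alternating-below M l ≤-refl h
alternating-above {suc M} l m≤M h h′ | inj₁ m<1+M
  rewrite hasOdds-false-mono (suc M) l m<1+M h′ | ℤₚ.*-zeroʳ (ε (suc M)) =
  trans (ℤₚ.+-identityʳ _) (alternating-above l (≤-pred m<1+M) h h′)

length≤size : Bounded k l → length l ≤ size l
length≤size none          = z≤n
length≤size (weaken b)    = length≤size b
length≤size (overlined b) = s≤s (m≤n⇒m≤o+n _ (length≤size b))
length≤size (plain b)     = s≤s (m≤n⇒m≤o+n _ (length≤size b))

indicator : Bool → ℤ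
indicator b = if b then 1ℤ else 0ℤ

-- `mexCond 1 l` reduces to `isMex3 (mex21 l)`, so the value of the mex can be substituted.
isMex3 : ℕ → Bool
isMex3 j = (3 ≤ᵇ j) ∧ (j % 4 ≡ᵇ 3)

-- 2m+1 is 3 modulo 4 exactly when m is odd, that is when `ε m` is -1; both sides of this have
-- period 2 in m.
isMex3-odd : ∀ m → ε m ℤ.+ 2ℤ ℤ.* indicator (isMex3 (2 * m + 1)) ≡ 1ℤ
isMex3-odd m = trans (cong (λ b → ε m ℤ.+ 2ℤ ℤ.* indicator b) (large m)) (mod4 m)
  where
  large : ∀ m → isMex3 (2 * m + 1) ≡ ((2 * m + 1) % 4 ≡ᵇ 3)
  large zero    = refl
  large (suc m) = cong (_∧ ((2 * suc m + 1) % 4 ≡ᵇ 3)) (Equivalence.to T-≡ (≤⇒≤ᵇ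
    (+-monoˡ-≤ 1 (subst (2 ≤_) (sym (*-suc 2 m)) (m≤m+n 2 (2 * m))))))
  period : ∀ m → 2 * suc (suc m) + 1 ≡ 2 * m + 1 + 4
  period = ℕ-Solver.solve-∀
  mod4 : ∀ m → ε m ℤ.+ 2ℤ ℤ.* indicator ((2 * m + 1) % 4 ≡ᵇ 3) ≡ 1ℤ
  mod4 zero          = refl
  mod4 (suc zero)    = refl
  mod4 (suc (suc m)) = trans
    (cong₂ (λ e j → e ℤ.+ 2ℤ ℤ.* indicator (j ≡ᵇ 3)) (ℤₚ.neg-involutive (ε m))
      (trans (cong (_% 4) (period m)) ([m+n]%n≡m%n (2 * m + 1) 4)))
    (mod4 m)

count-singleton : ∀ p l → pos (count p (l ∷ [])) ≡ indicator (p l)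
count-singleton p l with p l
... | true  = refl
... | false = refl

alternating-mex : ∀ {M} l → Bounded k l → size l ≤ M →
  alternating M (l ∷ []) ℤ.+ 2ℤ ℤ.* pos (count (mexCond 1) (l ∷ [])) ≡ 1ℤ
alternating-mex l b size≤M with mex21-spec l
... | m , eq , h , h′ = trans
  (cong₂ (λ e x → e ℤ.+ 2ℤ ℤ.* x)
    -- The index of the mex is at most the length, hence at most the size, so truncating at `M`
    -- changes nothing.
    (alternating-above l (≤-trans (hasOdds⇒≤length m l h) (≤-trans (length≤size b) size≤M)) h h′)
    (trans (count-singleton (mexCond 1) l) (cong (indicator ∘ isMex3) eq)))
  (isMex3-odd m)

alternating-count : ∀ {M} xs → (∀ {l} → l ∈ xs → alternating M (l ∷ []) ℤ.+ 2ℤ ℤ.* pos (count (mexCond 1) (l ∷ [])) ≡ 1ℤ) →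
  alternating M xs ℤ.+ 2ℤ ℤ.* pos (count (mexCond 1) xs) ≡ pos (length xs)
alternating-count {M} [] _ = cong (ℤ._+ 0ℤ) (alternating-[] M)
alternating-count {M} (l ∷ xs) h = algebra
  (alternating M (l ∷ [])) (alternating M xs) (count (mexCond 1) (l ∷ [])) (count (mexCond 1) xs)
  (alternating-∷ M l xs) (count-++ (mexCond 1) (l ∷ []) xs)
  (h (here refl)) (alternating-count {M} xs (h ∘ there))
  where
  distribute : ∀ a b x y → a ℤ.+ b ℤ.+ 2ℤ ℤ.* (x ℤ.+ y) ≡ a ℤ.+ 2ℤ ℤ.* x ℤ.+ (b ℤ.+ 2ℤ ℤ.* y)
  distribute a b x y = ℤ-Solver.solve (a ∷ b ∷ x ∷ y ∷ [])
  algebra : ∀ a b x y {c z u v} → c ≡ a ℤ.+ b → z ≡ x + y →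
    a ℤ.+ 2ℤ ℤ.* pos x ≡ u → b ℤ.+ 2ℤ ℤ.* pos y ≡ v → c ℤ.+ 2ℤ ℤ.* pos z ≡ u ℤ.+ v
  algebra a b x y refl refl refl refl = distribute a b (pos x) (pos y)

-- Vanishing of the signed count and the conclusion

module _ (n : ℕ) where
  open Shanks (λ k a → pos (length (enum k a n))) (λ k a → cong pos (length-enum-rec k a n))
              n (λ k a n<a → cong (pos ∘ length) (enum-vanish k n<a))

  alternating≡D : ∀ M → alternating M (enum n 0 n) ≡ D n M 0
  alternating≡D zero    = refl
  alternating≡D (suc M) = cong₂ (λ d x → d ℤ.+ 2ℤ ℤ.* (ε (suc M) ℤ.* pos x)) (alternating≡D M) (count-hasOdds-enum n (suc M))

  length-enum-double : length (enum 0 0 n) ≡ 0 → length (enum n 0 n) ≡ 2 * count (mexCond 1) (enum n 0 n)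
  length-enum-double p0≡0 = ℤₚ.+-injective (sym (begin
    pos (2 * c)                                  ≡⟨ ℤₚ.pos-* 2 c ⟩
    2ℤ ℤ.* pos c                                 ≡⟨ ℤₚ.+-identityˡ _ ⟨
    0ℤ ℤ.+ 2ℤ ℤ.* pos c
      ≡⟨ cong (ℤ._+ 2ℤ ℤ.* pos c) (trans (alternating≡D n) (gauss n ≤-refl (cong pos p0≡0))) ⟨
    alternating n (enum n 0 n) ℤ.+ 2ℤ ℤ.* pos c  ≡⟨ alternating-count {n} (enum n 0 n) pointwise ⟩
    pos (length (enum n 0 n))                    ∎))
    where
    open ≡-Reasoning
    c = count (mexCond 1) (enum n 0 n)
    pointwise : ∀ {l} → l ∈ enum n 0 n → alternating n (l ∷ []) ℤ.+ 2ℤ ℤ.* pos (count (mexCond 1) (l ∷ [])) ≡ 1ℤ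
    pointwise {l} l∈ with enum-sound n 0 n l∈
    ... | b , eq = alternating-mex l b (≤-reflexive eq)

theorem2p3 : (n : ℕ) → 1 ≤ n →
    ∃[ c ] (HasSize (OP21 n 1) c × HasSize (Overpartition n) (2 * c))
theorem2p3 n@(suc _) 1≤n = count (mexCond 1) xs
  , list-hasSize (filter (T? ∘ mexCond 1) xs) (Unique.filter⁺ (T? ∘ mexCond 1) xs-unique) _ ∈-filter⇔
  -- `refl` applies because n is a successor: without parts only 0 can be reached.
  , subst (HasSize (Overpartition n)) (length-enum-double n refl) (list-hasSize xs xs-unique _ (∈-enum⇔ n))
  where
  xs = enum n 0 n
  xs-unique = enum-unique n 0 n
  ∈-filter⇔ : ∀ l → l ∈ filter (T? ∘ mexCond 1) xs ⇔ T (validOP l ∧ (size l ≡ᵇ n) ∧ mexCond 1 l)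
  ∈-filter⇔ l = mk⇔
    (λ l∈ → let (l∈xs , mex) = ∈-filter⁻ (T? ∘ mexCond 1) {xs = xs} l∈ in
            subst T (∧-assoc (validOP l) _ _) (Equivalence.from T-∧ (Equivalence.to (∈-enum⇔ n l) l∈xs , mex)))
    (λ p → let (p′ , mex) = Equivalence.to T-∧ (subst T (sym (∧-assoc (validOP l) _ _)) p) in
           ∈-filter⁺ (T? ∘ mexCond 1) (Equivalence.from (∈-enum⇔ n l) p′) mex)
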